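{- Let $t \ge 3$ be an integer. For every $N \in \mathbb{N}$ there exists a $t$-chordal digraph $D$ with $\omega(D) \le 3$ and $\vec{\chi}(D) \ge N$; moreover, if $t > 3$, then such a $D$ exists with $\omega(D) \le 2$.
   Context: All digraphs are finite and simple: no loops, no parallel edges, and for two vertices $u,v$ not both of the edges $uv$ and $vu$ are present. A digraph is acyclic if it has no directed cycle. A $k$-dicoloring of a digraph $D$ is a function $f: V(D) \to \{1,\dots,k\}$ such that for each $i$, $f^{ -1}(i)$ induces an acyclic subdigraph of $D$. The dichromatic number $\vec{\chi}(D)$ is the minimum $k$ such that $D$ has a $k$-dicoloring. $\omega(D)$ denotes the clique number of the underlying undirected graph of $D$ (two vertices adjacent iff $uv$ or $vu$ is an edge of $D$). For an integer $t \ge 2$, a digraph is $t$-chordal if every induced directed cycle in it has length exactly $t$. -}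

module Defs where

open import Data.Nat using (ℕ; zero; suc; _≤_; _<_)
open import Data.Fin using (Fin; toℕ)
open import Data.Bool using (Bool; true; false)
open import Data.Product using (Σ; _×_; _,_)
open import Data.Sum using (_⊎_)
open import Relation.Binary.PropositionalEquality using (_≡_; _≢_)
open import Relation.Nullary using (¬_)
open import Function.Definitions using (Injective)

record Digraph : Set where
  field
    n     : ℕ
    arc   : Fin n → Fin n → Bool
    loopless : ∀ v → arc v v ≡ false
    asym  : ∀ u v → arc u v ≡ true → arc v u ≡ false

open Digraph public

CycSucc : (k : ℕ) → Fin k → Fin k → Set
CycSucc k i j = (suc (toℕ i) ≡ toℕ j) ⊎ ((suc (toℕ i) ≡ k) × (toℕ j ≡ 0))

IsDirCycle : (D : Digraph) (k : ℕ) → (Fin k → Fin (n D)) → Set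
IsDirCycle D k c =
  (2 ≤ k) × Injective _≡_ _≡_ c × (∀ i j → CycSucc k i j → arc D (c i) (c j) ≡ true)

IsInducedDirCycle : (D : Digraph) (k : ℕ) → (Fin k → Fin (n D)) → Set
IsInducedDirCycle D k c =
  IsDirCycle D k c × (∀ i j → arc D (c i) (c j) ≡ true → CycSucc k i j)

IsChordal : ℕ → Digraph → Set
IsChordal t D = ∀ k (c : Fin k → Fin (n D)) → IsInducedDirCycle D k c → k ≡ t

UAdj : (D : Digraph) → Fin (n D) → Fin (n D) → Set
UAdj D u v = (arc D u v ≡ true) ⊎ (arc D v u ≡ true)

IsClique : (D : Digraph) (m : ℕ) → (Fin m → Fin (n D)) → Set
IsClique D m c = Injective _≡_ _≡_ c × (∀ i j → i ≢ j → UAdj D (c i) (c j))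

CliqueNumber≤ : Digraph → ℕ → Set
CliqueNumber≤ D w = ∀ m (c : Fin m → Fin (n D)) → IsClique D m c → m ≤ w

IsDicoloring : (D : Digraph) (k : ℕ) → (Fin (n D) → Fin k) → Set
IsDicoloring D k f =
  ∀ (col : Fin k) m (c : Fin m → Fin (n D)) → IsDirCycle D m c → ¬ (∀ i → f (c i) ≡ col)

Dichromatic≥ : Digraph → ℕ → Set
Dichromatic≥ D N = ∀ k (f : Fin (n D) → Fin k) → IsDicoloring D k f → N ≤ k

{-# OPTIONS --safe #-}

-- Take an acyclic digraph whose vertices are partially ordered as a forest, with arcs pointing
-- upwards, and close each of its paths with t − 1 arcs to a directed t-cycle.  If its chromatic
-- number is large, then so is the dichromatic number of the closure: were no path with t − 1 arcs
-- monochromatic, the pairs (colour, length of a longest monochromatic path from the vertex) would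
-- be a proper colouring with few colours (Gallai–Roy).
--
-- The digraph is a tree version of Zykov's construction.  To exhibit k + 1 colours, take a tuple of
-- vertices showing k colours, place a fresh copy of everything above this tuple, and choose in the
-- copy a vertex of a new colour; such a vertex exists since a tuple with k colours in the copy and
-- the vertex joined from all of it show k + 1 colours.  The noncrossing property of the result
-- implies that directed paths are unique, so that lengths add up along cliques.  It also implies
-- that an induced directed cycle of the closure has a lowest vertex x from which all its vertices
-- are reachable by forward arcs: the first backward arc of the cycle after x then returns to a
-- vertex met since x, so the cycle has length t.
module Submission where

open import Defs
open import Data.Nat using (ℕ; _≤_; _<_)
open import Data.Product using (Σ; _×_)

open import Data.Bool using (true)
open import Data.Empty using (⊥; ⊥-elim)
open import Data.Fin as Fin using (Fin; toℕ; fromℕ<; combine)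
import Data.Fin.Properties as Fin
open import Data.List using (List; []; _∷_; length)
open import Data.List.Relation.Unary.All as All using (All; []; _∷_)
open import Data.List.Relation.Unary.AllPairs using (AllPairs; []; _∷_)
open import Data.Nat using (zero; suc; _+_; _*_; _∸_; z≤n; s≤s; NonZero; >-nonZero)
open import Data.Nat.DivMod
  using (_%_; _/_; m%n<n; m≡m%n+[m/n]*n; m<n⇒m%n≡m; n%n≡0; [m+n]%n≡m%n; [m+kn]%n≡m%n)
open import Data.Nat.Divisibility using (_∣_; divides; ∣⇒≤; ∣m+n∣m⇒∣n; n∣m*n)
open import Data.Nat.Properties
open import Data.Product using (_,_; proj₁; proj₂; ∃; ∃-syntax)
open import Data.Product.Function.NonDependent.Propositional using (_×-↔_)
open import Data.Sum using (_⊎_; inj₁; inj₂)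
open import Data.Sum.Function.Propositional using (_⊎-↔_)
open import Data.Unit using (⊤)
open import Function using (_∘_; flip; case_of_; Inverse; _↔_)
open import Function.Definitions using (Injective)
open import Function.Properties.Inverse using (↔-sym; ↔-trans; ↔⇒↣)
open import Relation.Binary.Construct.Closure.ReflexiveTransitive using (Star; ε; _◅_; _◅◅_)
open import Relation.Binary.Definitions using (Decidable; DecidableEquality; tri<; tri≈; tri>)
open import Relation.Binary.PropositionalEquality
open import Relation.Nullary using (¬_; Dec; yes; no; does)
open import Relation.Nullary.Decidable
  using (map′; _×-dec_; _⊎-dec_; ¬?; via-injection; dec-true; dec-false; decidable-stable)

-- Finite types and search through them.

Finite : Set → ℕ → Set
Finite A n = A ↔ Fin n

module _ {A : Set} {n : ℕ} (fin : Finite A n) where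

  finite-≟ : DecidableEquality A
  finite-≟ = via-injection (↔⇒↣ fin) Fin._≟_

  finite-any? : {P : A → Set} → (∀ a → Dec (P a)) → Dec (∃ P)
  finite-any? {P} P? = map′
    (λ (i , p) → Inverse.from fin i , p)
    (λ (a , p) → Inverse.to fin a , subst P (sym (Inverse.strictlyInverseʳ fin a)) p)
    (Fin.any? (P? ∘ Inverse.from fin))

-- Walk lengths as a proper colouring (Gallai-Roy).

module Rank {V : Set} {n : ℕ} (fin : Finite V n) {_⟶_ : V → V → Set} (_⟶?_ : Decidable _⟶_) where

  Walk : ℕ → V → Set
  Walk zero    u = ⊤
  Walk (suc j) u = ∃[ v ] (u ⟶ v × Walk j v)

  walk? : ∀ j u → Dec (Walk j u)
  walk? zero    u = yes _
  walk? (suc j) u = finite-any? fin λ v → (u ⟶? v) ×-dec walk? j v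

  vertex : ∀ j {u} → Walk j u → ℕ → V
  -- Indices beyond the end of the walk yield its last vertex.
  vertex zero    {u} _           _       = u
  vertex (suc j) {u} _           zero    = u
  vertex (suc j) {u} (_ , _ , w) (suc i) = vertex j w i

  vertex-zero : ∀ j {u} (w : Walk j u) → vertex j w 0 ≡ u
  vertex-zero zero    w = refl
  vertex-zero (suc j) w = refl

  vertex-arc : ∀ j {u} (w : Walk j u) i → i < j → vertex j w i ⟶ vertex j w (suc i)
  vertex-arc (suc j) {u} (v , e , w) zero    _         = subst (u ⟶_) (sym (vertex-zero j w)) e
  vertex-arc (suc j)     (v , e , w) (suc i) (s≤s i<j) = vertex-arc j w i i<j

  -- The number of vertices, capped at s, of a longest walk from u.
  rank : ℕ → V → ℕ
  rank zero    u = 0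
  rank (suc s) u with walk? s u
  ... | yes _ = suc s
  ... | no  _ = rank s u

  rank≤ : ∀ s u → rank s u ≤ s
  rank≤ zero    u = z≤n
  rank≤ (suc s) u with walk? s u
  ... | yes _ = ≤-refl
  ... | no  _ = m≤n⇒m≤1+n (rank≤ s u)

  rank⇒walk : ∀ s u {j} → rank s u ≡ suc j → Walk j u
  rank⇒walk (suc s) u eq with walk? s u
  ... | yes w = subst (λ j → Walk j u) (suc-injective eq) w
  ... | no  _ = rank⇒walk s u eq

  walk⇒rank : ∀ s {u j} → Walk j u → j < s → j < rank s u
  walk⇒rank (suc s) {u} w j<1+s with walk? s u
  ... | yes _ = j<1+s
  ... | no ¬w with m≤n⇒m<n∨m≡n (≤-pred j<1+s)
  ...   | inj₁ j<s  = walk⇒rank s w j<s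
  ...   | inj₂ refl = ⊥-elim (¬w w)

  -- An arc from `u` to `v` prolongs a longest walk from `v`. Since no walk has `s` arcs, the cap
  -- does not hide this and `u` gets the larger rank.
  rank-proper : ∀ s → 0 < s → (∀ u → ¬ Walk s u) → ∀ {u v} → u ⟶ v → rank s u ≢ rank s v
  rank-proper s 0<s ¬walk {u} {v} e eq with rank s v in rank≡ | walk⇒rank s {v} _ 0<s
  ... | suc j | _ = <-irrefl (sym eq) (walk⇒rank s w (≤∧≢⇒< 1+j≤s λ { refl → ¬walk u w }))
    where
    w : Walk (suc j) u
    w = v , e , rank⇒walk s v rank≡
    1+j≤s : suc j ≤ s
    1+j≤s = subst (_≤ s) rank≡ (rank≤ s v)

-- Cyclic indices as residues.

module _ {k : ℕ} .{{_ : NonZero k}} where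

  residue : ℕ → Fin k
  residue i = fromℕ< (m%n<n i k)

  toℕ-residue : ∀ i → toℕ (residue i) ≡ i % k
  toℕ-residue i = Fin.toℕ-fromℕ< (m%n<n i k)

  residue-cong : ∀ i j → i % k ≡ j % k → residue i ≡ residue j
  residue-cong i j eq =
    Fin.toℕ-injective (trans (toℕ-residue i) (trans eq (sym (toℕ-residue j))))

  residue-injective : ∀ d i → residue i ≡ residue (d + i) → k ∣ d
  residue-injective d i eq = ∣m+n∣m⇒∣n (divides ((d + i) / k) difference) (n∣m*n (i / k))
    where
    open ≡-Reasoning
    remainder : i % k ≡ (d + i) % k
    remainder = trans (sym (toℕ-residue i)) (trans (cong toℕ eq) (toℕ-residue (d + i)))
    difference : (i / k) * k + d ≡ ((d + i) / k) * k
    difference = +-cancelˡ-≡ (i % k) _ _ (begin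
      i % k + ((i / k) * k + d)            ≡⟨ +-assoc (i % k) _ d ⟨
      i % k + (i / k) * k + d              ≡⟨ cong (_+ d) (m≡m%n+[m/n]*n i k) ⟨
      i + d                                ≡⟨ +-comm i d ⟩
      d + i                                ≡⟨ m≡m%n+[m/n]*n (d + i) k ⟩
      (d + i) % k + ((d + i) / k) * k      ≡⟨ cong (_+ (d + i) / k * k) remainder ⟨
      i % k + ((d + i) / k) * k            ∎)

  [1+i]%k : ∀ i → suc i % k ≡ suc (i % k) % k
  [1+i]%k i = begin
    suc i % k                            ≡⟨ cong (λ j → suc j % k) (m≡m%n+[m/n]*n i k) ⟩
    (suc (i % k) + (i / k) * k) % k      ≡⟨ [m+kn]%n≡m%n (suc (i % k)) (i / k) k ⟩
    suc (i % k) % k                      ∎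
    where open ≡-Reasoning

  residue-suc : ∀ i → CycSucc k (residue i) (residue (suc i))
  residue-suc i with m≤n⇒m<n∨m≡n (m%n<n i k)
  ... | inj₁ <k = inj₁ (trans (cong suc (toℕ-residue i))
                  (sym (trans (toℕ-residue (suc i)) (trans ([1+i]%k i) (m<n⇒m%n≡m <k)))))
  ... | inj₂ ≡k = inj₂ (trans (cong suc (toℕ-residue i)) ≡k ,
                  trans (toℕ-residue (suc i)) (trans ([1+i]%k i) (trans (cong (_% k) ≡k) (n%n≡0 k))))

cycSucc-injective : ∀ {k} {a b c : Fin k} → CycSucc k a c → CycSucc k b c → a ≡ b
cycSucc-injective (inj₁ p) (inj₁ q) = Fin.toℕ-injective (suc-injective (trans p (sym q)))
cycSucc-injective (inj₁ p) (inj₂ (_ , z)) with () ← trans p z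
cycSucc-injective (inj₂ (_ , z)) (inj₁ q) with () ← trans q z
cycSucc-injective (inj₂ (p , _)) (inj₂ (q , _)) =
  Fin.toℕ-injective (suc-injective (trans p (sym q)))

does⇒ : {A : Set} (a? : Dec A) → does a? ≡ true → A
does⇒ (yes a) _ = a

-- Forest-ordered digraphs and uniqueness of their paths.

record ForestDigraph (V : Set) : Set₁ where
  infix 4 _⊏_ _⊑_ _⟶_ _⇝_
  field
    _⊏_ _⟶_ : V → V → Set

  _⊑_ : V → V → Set
  u ⊑ v = u ≡ v ⊎ u ⊏ v

  -- Reversed, so that pattern matching exposes the last arc.
  _⇝_ : V → V → Set
  u ⇝ v = Star (flip _⟶_) v u

  field
    _⊏?_      : Decidable _⊏_
    _⟶?_      : Decidable _⟶_
    ⊏-irrefl  : ∀ {v} → ¬ v ⊏ v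
    ⊏-trans   : ∀ {u v w} → u ⊏ v → v ⊏ w → u ⊏ w
    ⊏-compare : ∀ {u v w} → u ⊏ w → v ⊏ w → u ⊑ v ⊎ v ⊏ u
    ⟶⇒⊏       : ∀ {u v} → u ⟶ v → u ⊏ v
    -- Once v has been used as a tail on some branch above it, no vertex of this branch has an arc
    -- from an a that is older than v but not older than some x from which v is reachable.
    noncrossing : ∀ {x a v m b w} → x ⊑ a → x ⇝ v → a ⊏ v → v ⊏ m →
                  m ⊑ b → m ⊑ w → a ⟶ b → v ⟶ w → ⊥

  ⊑-⊏-trans : ∀ {u v w} → u ⊑ v → v ⊏ w → u ⊏ w
  ⊑-⊏-trans (inj₁ refl) q = q
  ⊑-⊏-trans (inj₂ p)    q = ⊏-trans p q

  ⊑-trans : ∀ {u v w} → u ⊑ v → v ⊑ w → u ⊑ w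
  ⊑-trans p (inj₁ refl) = p
  ⊑-trans p (inj₂ q)    = inj₂ (⊑-⊏-trans p q)

  ⊑-compare : ∀ {u v w} → u ⊑ w → v ⊑ w → u ⊑ v ⊎ v ⊏ u
  ⊑-compare (inj₁ refl) (inj₁ refl) = inj₁ (inj₁ refl)
  ⊑-compare (inj₁ refl) (inj₂ q)    = inj₂ q
  ⊑-compare (inj₂ p)    (inj₁ refl) = inj₁ (inj₂ p)
  ⊑-compare (inj₂ p)    (inj₂ q)    = ⊏-compare p q

  ⇝⇒⊑ : ∀ {u v} → u ⇝ v → u ⊑ v
  ⇝⇒⊑ ε       = inj₁ refl
  ⇝⇒⊑ (e ◅ r) = inj₂ (⊑-⊏-trans (⇝⇒⊑ r) (⟶⇒⊏ e))

  last-arc : ∀ {u w} → u ⇝ w → u ≡ w ⊎ ∃[ v ] (u ⇝ v × v ⟶ w)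
  last-arc ε       = inj₁ refl
  last-arc (e ◅ r) = inj₂ (_ , r , e)

  -- Both tails lie below `w`, hence are comparable. If they differed, the two arcs would contradict
  -- `noncrossing` with `w` itself as `m`.
  last-arc-unique : ∀ {x u v w} → x ⇝ u → x ⇝ v → u ⟶ w → v ⟶ w → u ≡ v
  last-arc-unique p q e f with ⊏-compare (⟶⇒⊏ e) (⟶⇒⊏ f)
  ... | inj₁ (inj₁ u≡v) = u≡v
  ... | inj₁ (inj₂ u⊏v) =
    ⊥-elim (noncrossing (⇝⇒⊑ p) q u⊏v (⟶⇒⊏ f) (inj₁ refl) (inj₁ refl) e f)
  ... | inj₂ v⊏u =
    ⊥-elim (noncrossing (⇝⇒⊑ q) p v⊏u (⟶⇒⊏ e) (inj₁ refl) (inj₁ refl) f e)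

  -- Paths grow at their last arc, the one that `last-arc-unique` determines.
  Path : ℕ → V → V → Set
  Path zero    u v = u ≡ v
  Path (suc j) u v = ∃[ w ] (Path j u w × w ⟶ v)

  path⇒⇝ : ∀ j {u v} → Path j u v → u ⇝ v
  path⇒⇝ zero    refl        = ε
  path⇒⇝ (suc j) (w , p , e) = e ◅ path⇒⇝ j p

  path⇒⊏ : ∀ j {u v} → Path (suc j) u v → u ⊏ v
  path⇒⊏ j (w , p , e) = ⊑-⊏-trans (⇝⇒⊑ (path⇒⇝ j p)) (⟶⇒⊏ e)

  path-length-unique : ∀ i j {u v} → Path i u v → Path j u v → i ≡ j
  path-length-unique zero    zero    p q = refl
  path-length-unique zero    (suc j) refl q = ⊥-elim (⊏-irrefl (path⇒⊏ j q))
  path-length-unique (suc i) zero    p refl = ⊥-elim (⊏-irrefl (path⇒⊏ i p))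
  path-length-unique (suc i) (suc j) (w , p , e) (_ , q , f)
    with refl ← last-arc-unique (path⇒⇝ i p) (path⇒⇝ j q) e f
    = cong suc (path-length-unique i j p q)

  path-++ : ∀ i j {u v w} → Path i u v → Path j v w → Path (j + i) u w
  path-++ i zero    p refl        = p
  path-++ i (suc j) p (x , q , e) = x , path-++ i j p q , e

  path? : ∀ {n} → Finite V n → ∀ j → Decidable (Path j)
  path? fin zero    u v = finite-≟ fin u v
  path? fin (suc j) u v = finite-any? fin λ w → path? fin j u w ×-dec (w ⟶? v)

-- The closure of a forest digraph.

-- The digraph of the theorem, for t = s + 1: each forward path with s arcs is closed to a
-- directed cycle.
module Closure {V : Set} (F : ForestDigraph V) (r : ℕ) where
  open ForestDigraph F

  -- For `t = 3 + r` this is at least 2, so by uniqueness of path lengths no closing arc has the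
  -- same two ends as a forward arc.
  s : ℕ
  s = 2 + r

  Arc : V → V → Set
  Arc u v = u ⟶ v ⊎ Path s v u

  -- Adjacency in the closure with every arc turned upwards, so that cliques become chains.
  Link : V → V → Set
  Link u v = u ⟶ v ⊎ Path s u v

  Linked : V → V → Set
  Linked u v = Link u v ⊎ Link v u

  link⇒⊏ : ∀ {u v} → Link u v → u ⊏ v
  link⇒⊏ (inj₁ e) = ⟶⇒⊏ e
  link⇒⊏ (inj₂ p) = path⇒⊏ (1 + r) p

  not-both : ∀ {u v} → u ⟶ v → ¬ Path s u v
  not-both e p with () ← path-length-unique 1 s (_ , refl , e) p

  arc-irrefl : ∀ {v} → ¬ Arc v v
  arc-irrefl (inj₁ e) = ⊏-irrefl (⟶⇒⊏ e)
  arc-irrefl (inj₂ p) = ⊏-irrefl (path⇒⊏ (1 + r) p)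

  arc-asym : ∀ {u v} → Arc u v → ¬ Arc v u
  arc-asym (inj₁ e) (inj₁ f) = ⊏-irrefl (⊏-trans (⟶⇒⊏ e) (⟶⇒⊏ f))
  arc-asym (inj₁ e) (inj₂ p) = not-both e p
  arc-asym (inj₂ p) (inj₁ e) = not-both e p
  arc-asym (inj₂ p) (inj₂ q) = ⊏-irrefl (⊏-trans (path⇒⊏ (1 + r) p) (path⇒⊏ (1 + r) q))

  arc⇒link : ∀ {u v} → Arc u v → Linked u v
  arc⇒link (inj₁ e) = inj₁ (inj₁ e)
  arc⇒link (inj₂ p) = inj₂ (inj₂ p)

  arc? : ∀ {n} → Finite V n → Decidable Arc
  arc? fin u v = (u ⟶? v) ⊎-dec path? fin s v u

  -- Cliques of the closure.

  link-trans : ∀ {u v w} → Link u v → Link v w → Linked u w → Link u w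
  link-trans p q (inj₁ r) = r
  link-trans p q (inj₂ r) =
    ⊥-elim (⊏-irrefl (⊏-trans (⊏-trans (link⇒⊏ p) (link⇒⊏ q)) (link⇒⊏ r)))

  -- The insertion step of an insertion sort along `Link`. The last component, transfer of any
  -- property `Q`, is all that is kept of `xs` being a permutation of `v ∷ ws`.
  link-insert : ∀ v ws → AllPairs Link ws → All (Linked v) ws →
    Σ (List V) λ xs → AllPairs Link xs × length xs ≡ suc (length ws) ×
      (∀ {Q : V → Set} → Q v → All Q ws → All Q xs)
  link-insert v [] [] [] = v ∷ [] , [] ∷ [] , refl , λ q qs → q ∷ qs
  link-insert v (w ∷ ws) (w-ws ∷ sorted) (inj₁ v-w ∷ linked) =
    v ∷ w ∷ ws ,
    (v-w ∷ All.zipWith (λ (p , q) → link-trans v-w p q) (w-ws , linked)) ∷ w-ws ∷ sorted ,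
    refl , λ q qs → q ∷ qs
  link-insert v (w ∷ ws) (w-ws ∷ sorted) (inj₂ w-v ∷ linked) =
    let xs , sorted′ , len , all = link-insert v ws sorted linked
    in w ∷ xs , all w-v w-ws ∷ sorted′ , cong suc len , λ { q (r ∷ qs) → r ∷ all q qs }

  link-sort : ∀ m (c : Fin m → V) → (∀ i j → i ≢ j → Linked (c i) (c j)) →
    Σ (List V) λ xs → AllPairs Link xs × length xs ≡ m ×
      (∀ {Q : V → Set} → (∀ i → Q (c i)) → All Q xs)
  link-sort zero    c linked = [] , [] , refl , λ _ → []
  link-sort (suc m) c linked =
    let xs , sorted  , len  , all  = link-sort m (c ∘ Fin.suc)
                                       (λ i j i≢j → linked _ _ (i≢j ∘ Fin.suc-injective))
        ys , sorted′ , len′ , all′ = link-insert (c Fin.zero) xs sorted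
                                       (all λ i → linked Fin.zero (Fin.suc i) λ ())
    in ys , sorted′ , trans len′ (cong suc len) , λ q → all′ (q Fin.zero) (all (q ∘ Fin.suc))

  -- Path lengths add up along a triangle, and all of them are 1 or s.
  triangle : ∀ {u v w} → Link u v → Link v w → Link u w → r ≡ 0 × u ⟶ v × Path s u w
  triangle {u} {v} {w} = λ where
      (inj₁ e) (inj₁ f) (inj₁ g) → case lengths 1 1 1 (path₁ e) (path₁ f) (path₁ g) of λ ()
      (inj₁ e) (inj₁ f) (inj₂ p) →
        suc-injective (suc-injective (lengths 1 1 s (path₁ e) (path₁ f) p)) , e , p
      (inj₁ e) (inj₂ p) (inj₁ f) → case lengths 1 s 1 (path₁ e) p (path₁ f) of λ ()
      (inj₁ e) (inj₂ p) (inj₂ q) → ⊥-elim (m≢m+suc s (lengths 1 s s (path₁ e) p q))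
      (inj₂ p) (inj₁ e) (inj₁ f) → case lengths s 1 1 p (path₁ e) (path₁ f) of λ ()
      (inj₂ p) (inj₁ e) (inj₂ q) → ⊥-elim (1+n≢n (sym (lengths s 1 s p (path₁ e) q)))
      (inj₂ p) (inj₂ q) (inj₁ e) → case lengths s s 1 p q (path₁ e) of λ ()
      (inj₂ p) (inj₂ q) (inj₂ o) → ⊥-elim (m≢m+suc s (lengths s s s p q o))
    where
    path₁ : ∀ {x y} → x ⟶ y → Path 1 x y
    path₁ e = _ , refl , e
    lengths : ∀ i j k → Path i u v → Path j v w → Path k u w → k ≡ j + i
    lengths i j k p q o = path-length-unique k (j + i) o (path-++ i j p q)
    m≢m+suc : ∀ m {n} → m ≢ m + suc n
    m≢m+suc m eq = m≢1+m+n m (trans eq (+-suc m _))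

  clique≤2 : ∀ m (c : Fin m → V) → (∀ i j → i ≢ j → Linked (c i) (c j)) → r ≢ 0 → m ≤ 2
  clique≤2 m c linked r≢0 with link-sort m c linked
  ... | []        , _ , refl , _ = z≤n
  ... | _ ∷ []    , _ , refl , _ = s≤s z≤n
  ... | _ ∷ _ ∷ [] , _ , refl , _ = s≤s (s≤s z≤n)
  ... | _ ∷ _ ∷ _ ∷ _ , (ab ∷ ac ∷ _) ∷ (bc ∷ _) ∷ _ , _ =
    ⊥-elim (r≢0 (proj₁ (triangle ab bc ac)))

  clique≤3 : ∀ m (c : Fin m → V) → (∀ i j → i ≢ j → Linked (c i) (c j)) → m ≤ 3
  clique≤3 m c linked with link-sort m c linked
  ... | []        , _ , refl , _ = z≤n
  ... | _ ∷ []    , _ , refl , _ = s≤s z≤n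
  ... | _ ∷ _ ∷ [] , _ , refl , _ = s≤s (s≤s z≤n)
  ... | _ ∷ _ ∷ _ ∷ [] , _ , refl , _ = s≤s (s≤s (s≤s z≤n))
  ... | _ ∷ _ ∷ _ ∷ _ ∷ _ , (ab ∷ ac ∷ ad ∷ _) ∷ (bc ∷ _) ∷ (cd ∷ _) ∷ _ , _ =
    -- The second side of the first triangle is a path with `s` arcs, and it is a single arc as the
    -- lowest side of the other triangle.
    let _ , _ , p = triangle ab bc ac
        _ , e , _ = triangle ac cd ad
    in ⊥-elim (not-both e p)

  -- Induced directed cycles of the closure.

  minimum : (c : ℕ → V) → (∀ i → Arc (c i) (c (suc i))) →
            ∀ n → ∃[ j ] (∀ i → i ≤ n → c j ⊑ c i)
  minimum c step zero = 0 , λ { zero z≤n → inj₁ refl }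
  minimum c step (suc n) = extend (minimum c step n) (arc⇒link (step n))
    where
    below : ∀ {j} → (∀ i → i ≤ n → c j ⊑ c i) → c j ⊑ c (suc n) → ∀ i → i ≤ suc n → c j ⊑ c i
    below least last i i≤1+n with m≤n⇒m<n∨m≡n i≤1+n
    ... | inj₁ (s≤s i≤n) = least i i≤n
    ... | inj₂ refl      = last
    extend : ∃[ j ] (∀ i → i ≤ n → c j ⊑ c i) → Linked (c n) (c (suc n)) →
             ∃[ j ] (∀ i → i ≤ suc n → c j ⊑ c i)
    extend (j , least) (inj₁ l) = j , below least (⊑-trans (least n ≤-refl) (inj₂ (link⇒⊏ l)))
    -- After a descent, the old minimum and the new vertex both lie below `c n` or equal it, hence
    -- are comparable.
    extend (j , least) (inj₂ l) with ⊑-compare (least n ≤-refl) (inj₂ (link⇒⊏ l))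
    ... | inj₁ cj⊑ = j , below least cj⊑
    ... | inj₂ ⊏cj = suc n , below (λ i i≤n → ⊑-trans (inj₂ ⊏cj) (least i i≤n)) (inj₁ refl)

  -- Consider the last entry of the walk into the part above `v`. A backward arc cannot enter it, as
  -- its tail lies above its head; so a forward arc does, starting at `v` or jumping over it. The
  -- vertex `m` bounds how far the head of this arc and `c i` share a branch; it drops to
  -- `c (suc i)` when the walk descends below it.
  entry : (c : ℕ → V) → (∀ i → Arc (c i) (c (suc i))) → ∀ {v} → c 0 ⊑ v → ∀ i → v ⊏ c i →
    (∃[ j ] c j ≡ v) ⊎
    (∃[ j ] ∃[ m ] (c j ⟶ c (suc j) × c j ⊏ v × v ⊏ m × m ⊑ c (suc j) × m ⊑ c i))
  entry c step c₀⊑v zero v⊏c₀ = ⊥-elim (⊏-irrefl (⊑-⊏-trans c₀⊑v v⊏c₀))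
  entry c step {v} c₀⊑v (suc i) v⊏ with v ⊏? c i | step i
  ... | yes v⊏cᵢ | stepᵢ with entry c step c₀⊑v i v⊏cᵢ
  ...   | inj₁ on-cycle = inj₁ on-cycle
  ...   | inj₂ (j , m , e , cj⊏v , v⊏m , m⊑b , m⊑cᵢ) with arc⇒link stepᵢ
  ...     | inj₁ l = inj₂ (j , m , e , cj⊏v , v⊏m , m⊑b , ⊑-trans m⊑cᵢ (inj₂ (link⇒⊏ l)))
  ...     | inj₂ l with ⊑-compare m⊑cᵢ (inj₂ (link⇒⊏ l))
  ...       | inj₁ m⊑ = inj₂ (j , m , e , cj⊏v , v⊏m , m⊑b , m⊑)
  ...       | inj₂ ⊏m =
    inj₂ (j , c (suc i) , e , cj⊏v , v⊏ , ⊑-trans (inj₂ ⊏m) m⊑b , inj₁ refl)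
  entry c step c₀⊑v (suc i) v⊏ | no v⋢cᵢ | inj₂ p =
    ⊥-elim (v⋢cᵢ (⊏-trans v⊏ (path⇒⊏ (1 + r) p)))
  entry c step c₀⊑v (suc i) v⊏ | no v⋢cᵢ | inj₁ e with ⊏-compare (⟶⇒⊏ e) v⊏
  ... | inj₁ (inj₁ cᵢ≡v) = inj₁ (i , cᵢ≡v)
  ... | inj₁ (inj₂ cᵢ⊏v) = inj₂ (i , c (suc i) , e , cᵢ⊏v , v⊏ , inj₁ refl , inj₁ refl)
  ... | inj₂ v⊏cᵢ        = ⊥-elim (v⋢cᵢ v⊏cᵢ)

  -- Periodic indexing by ℕ makes rotating and stepping back plain arithmetic. By `chordless`, the
  -- only in-neighbour on the cycle of a cycle vertex is its predecessor.
  record InducedCycle (k : ℕ) : Set where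
    field
      nonempty  : 0 < k
      c         : ℕ → V
      period    : ∀ i → c (k + i) ≡ c i
      injective : ∀ d i → c i ≡ c (d + i) → k ∣ d
      step      : ∀ i → Arc (c i) (c (suc i))
      chordless : ∀ i j → Arc (c i) (c (suc j)) → c i ≡ c j

    periods : ∀ m i → c (m * k + i) ≡ c i
    periods zero    i = refl
    periods (suc m) i = trans (trans (cong c (+-assoc k (m * k) i)) (period (m * k + i))) (periods m i)

    instance
      k≢0 : NonZero k
      k≢0 = >-nonZero nonempty

  rotate : ∀ {k} → ℕ → InducedCycle k → InducedCycle k
  rotate {k} n C = record
    { nonempty  = nonempty
    ; c         = λ i → c (i + n)
    ; period    = λ i → trans (cong c (+-assoc k i n)) (period (i + n))
    ; injective = λ d i eq → injective d (i + n) (trans eq (cong c (+-assoc d i n)))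
    ; step      = λ i → step (i + n)
    ; chordless = λ i j → chordless (i + n) (j + n)
    }
    where open InducedCycle C

  module Rooted {k : ℕ} (C : InducedCycle k)
                (root : ∀ i → InducedCycle.c C 0 ⊑ InducedCycle.c C i) where
    open InducedCycle C

    -- A backward arc to `c (suc i)` comes with a forward path from there to `c i`. Otherwise the
    -- last arc `v ⟶ c (suc i)` of the given path competes with the cycle arc: `noncrossing`
    -- excludes a `v` above `c i`, and for `v` below `c i` either `v` is on the cycle and
    -- `chordless` applies, or a cycle arc jumps over `v`, again against `noncrossing`.
    reachable-pred : ∀ i → c 0 ⇝ c (suc i) → c 0 ⇝ c i
    reachable-pred i reach with step i
    ... | inj₂ p = path⇒⇝ s p ◅◅ reach
    ... | inj₁ e with last-arc reach
    ...   | inj₁ c₀≡ =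
      ⊥-elim (⊏-irrefl (⊑-⊏-trans (root i) (subst (c i ⊏_) (sym c₀≡) (⟶⇒⊏ e))))
    ...   | inj₂ (v , c₀⇝v , f) with ⊏-compare (⟶⇒⊏ e) (⟶⇒⊏ f)
    ...     | inj₁ (inj₁ cᵢ≡v) = subst (c 0 ⇝_) (sym cᵢ≡v) c₀⇝v
    ...     | inj₁ (inj₂ cᵢ⊏v) =
      ⊥-elim (noncrossing (root i) c₀⇝v cᵢ⊏v (⟶⇒⊏ f) (inj₁ refl) (inj₁ refl) e f)
    ...     | inj₂ v⊏cᵢ with entry c step (⇝⇒⊑ c₀⇝v) i v⊏cᵢ
    ...       | inj₁ (j , refl) = subst (c 0 ⇝_) (chordless j i (inj₁ f)) c₀⇝v
    ...       | inj₂ (j , m , g , a⊏v , v⊏m , m⊑b , m⊑cᵢ) =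
      ⊥-elim (noncrossing (root j) c₀⇝v a⊏v v⊏m m⊑b (⊑-trans m⊑cᵢ (inj₂ (⟶⇒⊏ e))) g f)

    reachable-before : ∀ d i → c 0 ⇝ c (d + i) → c 0 ⇝ c i
    reachable-before zero    i reach = reach
    reachable-before (suc d) i reach = reachable-before d i (reachable-pred (d + i) reach)

    reachable : ∀ i → c 0 ⇝ c i
    -- Index `i * k` denotes the root again and is at least `i`, so stepping back from it reaches
    -- `i`.
    reachable i = reachable-before (i * k ∸ i) i
      (subst (c 0 ⇝_) (trans (sym (periods i 0)) (cong c multiple)) ε)
      where
      multiple : i * k + 0 ≡ i * k ∸ i + i
      multiple = trans (+-identityʳ (i * k)) (sym (m∸n+n≡m (m≤m*n i k)))

    Forward : ℕ → Set
    Forward j = ∀ i → i < j → c i ⟶ c (suc i)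

    forward-⊏ : ∀ j → 0 < j → Forward j → c 0 ⊏ c j
    forward-⊏ (suc j) _ fwd = ⊑-⊏-trans (root j) (⟶⇒⊏ (fwd j ≤-refl))

    -- The path and the initial stretch of the cycle both end at `c j`, with tails reachable from
    -- the root, so their last arcs agree; this repeats downwards.
    path-along : ∀ j → Forward j → ∀ e {u} → c 0 ⇝ u → Path e u (c j) →
                 ∃[ i ] (u ≡ c i × j ≡ e + i)
    path-along j fwd zero reach refl = j , refl , refl
    path-along zero fwd (suc e) reach p =
      ⊥-elim (⊏-irrefl (⊑-⊏-trans (⇝⇒⊑ reach) (path⇒⊏ e p)))
    path-along (suc j) fwd (suc e) reach (w , p , w⟶)
      with refl ← last-arc-unique (path⇒⇝ e p ◅◅ reach) (reachable j) w⟶ (fwd j ≤-refl)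
      with i , u≡ , j≡ ← path-along j (λ i i<j → fwd i (m≤n⇒m≤1+n i<j)) e reach p
      = i , u≡ , cong suc j≡

    -- A full turn of forward arcs would climb from `c 0` to itself.
    forward<k : ∀ j → Forward j → j < k
    forward<k j fwd = ≰⇒> λ k≤j → ⊏-irrefl (subst (c 0 ⊏_)
      (trans (cong c (sym (+-identityʳ k))) (period 0))
      (forward-⊏ k nonempty λ i i<k → fwd i (<-≤-trans i<k k≤j)))

    forward-or-done : ∀ j → Forward j ⊎ k ≡ suc s
    forward-or-done zero = inj₁ λ _ ()
    forward-or-done (suc j) with forward-or-done j
    ... | inj₂ done = inj₂ done
    ... | inj₁ fwd with step j
    ...   | inj₁ e = inj₁ λ i i<1+j → extend i (m≤n⇒m<n∨m≡n (≤-pred i<1+j))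
      where
      extend : ∀ i → i < j ⊎ i ≡ j → c i ⟶ c (suc i)
      extend i (inj₁ i<j)  = fwd i i<j
      extend i (inj₂ refl) = e
    -- The first backward arc returns to `c i` with `j = s + i`. Hence `k` divides `suc s`, and
    -- `s ≤ j < k` leaves only equality.
    ...   | inj₂ p with i , eq , j≡ ← path-along j fwd s (reachable (suc j)) p
      = inj₂ (≤-antisym
          (∣⇒≤ (injective (suc s) i (trans (sym eq) (cong (c ∘ suc) j≡))))
          (≤-trans (s≤s (subst (s ≤_) (sym j≡) (m≤m+n s i))) (forward<k j fwd)))

    length≡ : k ≡ suc s
    length≡ with forward-or-done k
    ... | inj₂ done = done
    ... | inj₁ fwd  = ⊥-elim (<-irrefl refl (forward<k k fwd))

  induced-cycle-length : ∀ {k} → InducedCycle k → k ≡ suc s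
  induced-cycle-length {k} C = Rooted.length≡ (rotate j C) λ i →
      subst (c j ⊑_) (wrap (i + j)) (least _ (<⇒≤ (m%n<n (i + j) k)))
    where
    open InducedCycle C
    j = proj₁ (minimum c step k)
    least = proj₂ (minimum c step k)
    wrap : ∀ i → c (i % k) ≡ c i
    wrap i = sym (trans (cong c (trans (m≡m%n+[m/n]*n i k) (+-comm (i % k) _)))
                        (periods (i / k) (i % k)))

  -- The closure as a `Digraph`, and its dichromatic number.

  module Realisation {n : ℕ} (fin : Finite V n) where
    open Inverse fin using (to; from)

    from∘to : ∀ v → from (to v) ≡ v
    from∘to = Inverse.strictlyInverseʳ fin

    from-injective : ∀ {i j} → from i ≡ from j → i ≡ j
    from-injective {i} {j} eq = trans (sym (Inverse.strictlyInverseˡ fin i))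
      (trans (cong to eq) (Inverse.strictlyInverseˡ fin j))

    arc-dec : Decidable Arc
    arc-dec = arc? fin

    digraph : Digraph
    digraph = record
      { n        = n
      ; arc      = λ i j → does (arc-dec (from i) (from j))
      ; loopless = λ i → dec-false (arc-dec _ _) arc-irrefl
      ; asym     = λ i j ij → dec-false (arc-dec _ _)
                     (arc-asym (does⇒ (arc-dec (from i) (from j)) ij))
      }

    arc⇒ : ∀ i j → arc digraph i j ≡ true → Arc (from i) (from j)
    arc⇒ i j = does⇒ (arc-dec (from i) (from j))

    adjacent⇒linked : ∀ i j → UAdj digraph i j → Linked (from i) (from j)
    adjacent⇒linked i j (inj₁ ij) = arc⇒link (arc⇒ i j ij)
    adjacent⇒linked i j (inj₂ ji) with arc⇒link (arc⇒ j i ji)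
    ... | inj₁ l = inj₂ l
    ... | inj₂ l = inj₁ l

    clique-number≤3 : CliqueNumber≤ digraph 3
    clique-number≤3 m c (_ , adj) =
      clique≤3 m (from ∘ c) λ i j i≢j → adjacent⇒linked _ _ (adj i j i≢j)

    clique-number≤2 : r ≢ 0 → CliqueNumber≤ digraph 2
    clique-number≤2 r≢0 m c (_ , adj) =
      clique≤2 m (from ∘ c) (λ i j i≢j → adjacent⇒linked _ _ (adj i j i≢j)) r≢0

    chordal : IsChordal (suc s) digraph
    chordal k c ((2≤k , c-inj , c-step) , c-induced) = induced-cycle-length record
      { nonempty  = 0<k
      ; c         = from ∘ c ∘ residue
      ; period    = λ i → cong (from ∘ c) (residue-cong (k + i) i
                      (trans (cong (_% k) (+-comm k i)) ([m+n]%n≡m%n i k)))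
      ; injective = λ d i eq → residue-injective d i (c-inj (from-injective eq))
      ; step      = λ i → arc⇒ _ _ (c-step _ _ (residue-suc i))
      ; chordless = λ i j e → cong (from ∘ c)
                      (cycSucc-injective (c-induced _ _ (dec-true (arc-dec _ _) e)) (residue-suc j))
      }
      where
      0<k : 0 < k
      0<k = ≤-trans (s≤s z≤n) 2≤k
      instance
        k≢0 : NonZero k
        k≢0 = >-nonZero 0<k

    module _ {k : ℕ} (f : Fin n → Fin k) (dicoloring : IsDicoloring digraph k f) where

      open Rank fin (λ u v → (u ⟶? v) ×-dec (f (to u) Fin.≟ f (to v)))

      -- The closing arc would turn such a walk into a monochromatic directed cycle on `suc s`
      -- vertices.
      no-monochromatic-walk : ∀ u → ¬ Walk s u
      no-monochromatic-walk u w = dicoloring (f (to (p 0))) (suc s) cycle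
          (s≤s (s≤s z≤n) , cycle-injective , cycle-step)
          (λ i → sym (constant (toℕ i) (≤-pred (Fin.toℕ<n i))))
        where
        p : ℕ → V
        p = vertex s w
        constant : ∀ i → i ≤ s → f (to (p 0)) ≡ f (to (p i))
        constant zero    _   = refl
        constant (suc i) i<s = trans (constant i (<⇒≤ i<s)) (proj₂ (vertex-arc s w i i<s))
        path : ∀ i → i ≤ s → Path i (p 0) (p i)
        path zero    _   = refl
        path (suc i) i<s = p i , path i (<⇒≤ i<s) , proj₁ (vertex-arc s w i i<s)
        increasing : ∀ i j → i < j → j ≤ s → p i ⊏ p j
        increasing i (suc j) (s≤s i≤j) j<s =
          ⊑-⊏-trans (weakly (m≤n⇒m<n∨m≡n i≤j)) (⟶⇒⊏ (proj₁ (vertex-arc s w j j<s)))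
          where
          weakly : i < j ⊎ i ≡ j → p i ⊑ p j
          weakly (inj₁ i<j)  = inj₂ (increasing i j i<j (<⇒≤ j<s))
          weakly (inj₂ refl) = inj₁ refl
        cycle : Fin (suc s) → Fin n
        cycle i = to (p (toℕ i))
        p-injective : ∀ {i j} → i ≤ s → j ≤ s → p i ≡ p j → i ≡ j
        p-injective {i} {j} i≤s j≤s eq with <-cmp i j
        ... | tri< i<j _ _ = ⊥-elim (⊏-irrefl (subst (_⊏ p j) eq (increasing i j i<j j≤s)))
        ... | tri≈ _ i≡j _ = i≡j
        ... | tri> _ _ j<i = ⊥-elim (⊏-irrefl (subst (p j ⊏_) eq (increasing j i j<i i≤s)))
        cycle-injective : Injective _≡_ _≡_ cycle
        cycle-injective {i} {j} eq = Fin.toℕ-injective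
          (p-injective (≤-pred (Fin.toℕ<n i)) (≤-pred (Fin.toℕ<n j))
            (trans (sym (from∘to _)) (trans (cong from eq) (from∘to _))))
        closed : ∀ i j → j ≤ s → suc i ≡ j ⊎ (suc i ≡ suc s × j ≡ 0) → Arc (p i) (p j)
        closed i _ i<s (inj₁ refl)          = inj₁ (proj₁ (vertex-arc s w i i<s))
        closed _ _ _   (inj₂ (refl , refl)) = inj₂ (path s ≤-refl)
        cycle-step : ∀ i j → CycSucc (suc s) i j → arc digraph (cycle i) (cycle j) ≡ true
        cycle-step i j ij = dec-true (arc-dec _ _) (subst₂ Arc (sym (from∘to _)) (sym (from∘to _))
          (closed (toℕ i) (toℕ j) (≤-pred (Fin.toℕ<n j)) ij))

      -- The Gallai-Roy colouring within each colour class; ranks from 0 to `s` account for the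
      -- factor `suc s`.
      refined : V → Fin (k * suc s)
      refined v = combine (f (to v)) (fromℕ< (s≤s (rank≤ s v)))

      refined-proper : ∀ {u v} → u ⟶ v → refined u ≢ refined v
      refined-proper {u} {v} e eq with same-f , same-rank ← Fin.combine-injective _ _ _ _ eq =
        rank-proper s (s≤s z≤n) no-monochromatic-walk (e , same-f)
          (Fin.fromℕ<-injective _ _ _ _ same-rank)

    dichromatic≥ : ∀ {N} →
      (∀ {K} (g : V → Fin K) → (∀ {u v} → u ⟶ v → g u ≢ g v) → N * suc s ≤ K) →
      Dichromatic≥ digraph N
    dichromatic≥ {N} chromatic≥ k f dicoloring = *-cancelʳ-≤ N k (suc s)
      (chromatic≥ (refined f dicoloring) (refined-proper f dicoloring))

-- The tree version of Zykov's construction.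

-- P carries the arcs built so far and T indexes tuples of vertices of P, in pairwise unrelated
-- parts of it; as a vertex, a member of T is joined from all entries of its tuple.
record Level : Set₁ where
  field
    P T       : Set
    {|P| |T|} : ℕ
    P-finite  : Finite P |P|
    T-finite  : Finite T |T|
    forest    : ForestDigraph (P ⊎ T)

  finite : Finite (P ⊎ T) (|P| + |T|)
  finite = ↔-trans (P-finite ⊎-↔ T-finite) (↔-sym Fin.+↔⊎)

  open ForestDigraph forest public

-- The single member of `T` is the empty tuple, showing no colours.
base : Level
base = record
  { P = ⊥ ; T = ⊤ ; P-finite = ↔-sym Fin.0↔⊥ ; T-finite = ↔-sym Fin.1↔⊤
  ; forest = record
    { _⊏_ = λ _ _ → ⊥ ; _⟶_ = λ _ _ → ⊥ ; _⊏?_ = λ _ _ → no λ () ; _⟶?_ = λ _ _ → no λ ()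
    ; ⊏-irrefl = λ () ; ⊏-trans = λ () ; ⊏-compare = λ () ; ⟶⇒⊏ = λ () ; noncrossing = λ _ _ ()
    }
  }

-- Each tuple τ receives its own copy of the whole level, placed above τ, and is prolonged by each
-- vertex of this copy.
module Next (L : Level) where
  open Level L

  V P′ T′ V′ : Set
  V  = P ⊎ T
  P′ = P ⊎ (T × V)
  T′ = T × V
  V′ = P′ ⊎ T′

  pattern old p    = inj₁ (inj₁ p)
  pattern copy τ y = inj₁ (inj₂ (τ , y))
  pattern top τ y  = inj₂ (τ , y)

  infix 4 _⊏′_ _⊑′_ _⟶′_ _⇝′_

  data _⊏′_ : V′ → V′ → Set where
    old-old   : ∀ {p q}    → inj₁ p ⊏ inj₁ q → old p ⊏′ old q
    old-copy  : ∀ {p τ y}  → inj₁ p ⊏ inj₂ τ → old p ⊏′ copy τ y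
    old-top   : ∀ {p τ y}  → inj₁ p ⊏ inj₂ τ → old p ⊏′ top τ y
    copy-copy : ∀ {τ y y′} → y ⊏ y′ → copy τ y ⊏′ copy τ y′
    copy-top  : ∀ {τ y y′} → y ⊑ y′ → copy τ y ⊏′ top τ y′

  -- The copied tuples become ordinary vertices of `P′`, keeping their incoming arcs. The tuple
  -- `top τ y` inherits the entries of `τ` and gains the entry `copy τ y`.
  data _⟶′_ : V′ → V′ → Set where
    old-old   : ∀ {p q}    → inj₁ p ⟶ inj₁ q → old p ⟶′ old q
    old-top   : ∀ {p τ y}  → inj₁ p ⟶ inj₂ τ → old p ⟶′ top τ y
    copy-copy : ∀ {τ y y′} → y ⟶ y′ → copy τ y ⟶′ copy τ y′
    copy-top  : ∀ {τ y}    → copy τ y ⟶′ top τ y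

  _⊑′_ _⇝′_ : V′ → V′ → Set
  u ⊑′ v = u ≡ v ⊎ u ⊏′ v
  u ⇝′ v = Star (flip _⟶′_) v u

  _⊏′?_ : Decidable _⊏′_
  old p    ⊏′? old q     = map′ old-old (λ { (old-old p⊏q) → p⊏q }) (inj₁ p ⊏? inj₁ q)
  old p    ⊏′? copy τ y  = map′ old-copy (λ { (old-copy p⊏τ) → p⊏τ }) (inj₁ p ⊏? inj₂ τ)
  old p    ⊏′? top τ y   = map′ old-top (λ { (old-top p⊏τ) → p⊏τ }) (inj₁ p ⊏? inj₂ τ)
  copy τ y ⊏′? old q     = no λ ()
  copy τ y ⊏′? copy τ′ z with finite-≟ T-finite τ τ′
  ... | yes refl = map′ copy-copy (λ { (copy-copy y⊏z) → y⊏z }) (y ⊏? z)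
  ... | no  τ≢τ′ = no λ { (copy-copy _) → τ≢τ′ refl }
  copy τ y ⊏′? top τ′ z with finite-≟ T-finite τ τ′
  ... | yes refl = map′ copy-top (λ { (copy-top y⊑z) → y⊑z }) (finite-≟ finite y z ⊎-dec (y ⊏? z))
  ... | no  τ≢τ′ = no λ { (copy-top _) → τ≢τ′ refl }
  top τ y  ⊏′? v         = no λ ()

  _⟶′?_ : Decidable _⟶′_
  old p    ⟶′? old q     = map′ old-old (λ { (old-old e) → e }) (inj₁ p ⟶? inj₁ q)
  old p    ⟶′? copy τ y  = no λ ()
  old p    ⟶′? top τ y   = map′ old-top (λ { (old-top e) → e }) (inj₁ p ⟶? inj₂ τ)
  copy τ y ⟶′? old q     = no λ ()
  copy τ y ⟶′? copy τ′ z with finite-≟ T-finite τ τ′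
  ... | yes refl = map′ copy-copy (λ { (copy-copy e) → e }) (y ⟶? z)
  ... | no  τ≢τ′ = no λ { (copy-copy _) → τ≢τ′ refl }
  copy τ y ⟶′? top τ′ z with finite-≟ T-finite τ τ′ | finite-≟ finite y z
  ... | yes refl | yes refl = yes copy-top
  ... | no  τ≢τ′ | _        = no λ { copy-top → τ≢τ′ refl }
  ... | _        | no  y≢z  = no λ { copy-top → y≢z refl }
  top τ y  ⟶′? v         = no λ ()

  ⊏′-irrefl : ∀ {v} → ¬ v ⊏′ v
  ⊏′-irrefl (old-old p)   = ⊏-irrefl p
  ⊏′-irrefl (copy-copy p) = ⊏-irrefl p

  ⊏′-trans : ∀ {u v w} → u ⊏′ v → v ⊏′ w → u ⊏′ w
  ⊏′-trans (old-old p)   (old-old q)   = old-old (⊏-trans p q)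
  ⊏′-trans (old-old p)   (old-copy q)  = old-copy (⊏-trans p q)
  ⊏′-trans (old-old p)   (old-top q)   = old-top (⊏-trans p q)
  ⊏′-trans (old-copy p)  (copy-copy _) = old-copy p
  ⊏′-trans (old-copy p)  (copy-top _)  = old-top p
  ⊏′-trans (copy-copy p) (copy-copy q) = copy-copy (⊏-trans p q)
  ⊏′-trans (copy-copy p) (copy-top q)  = copy-top (⊑-trans (inj₂ p) q)

  ⊏′-⊑′-trans : ∀ {u v w} → u ⊏′ v → v ⊑′ w → u ⊏′ w
  ⊏′-⊑′-trans p (inj₁ refl) = p
  ⊏′-⊑′-trans p (inj₂ q)    = ⊏′-trans p q

  old-compare : ∀ {p q w} → inj₁ p ⊏ w → inj₁ q ⊏ w → old p ⊑′ old q ⊎ old q ⊏′ old p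
  old-compare p q with ⊏-compare p q
  ... | inj₁ (inj₁ refl) = inj₁ (inj₁ refl)
  ... | inj₁ (inj₂ p⊏q)  = inj₁ (inj₂ (old-old p⊏q))
  ... | inj₂ q⊏p         = inj₂ (old-old q⊏p)

  copy-compare : ∀ {τ y z w} → y ⊑ w → z ⊑ w → copy τ y ⊑′ copy τ z ⊎ copy τ z ⊏′ copy τ y
  copy-compare p q with ⊑-compare p q
  ... | inj₁ (inj₁ refl) = inj₁ (inj₁ refl)
  ... | inj₁ (inj₂ y⊏z)  = inj₁ (inj₂ (copy-copy y⊏z))
  ... | inj₂ z⊏y         = inj₂ (copy-copy z⊏y)

  ⊏′-compare : ∀ {u v w} → u ⊏′ w → v ⊏′ w → u ⊑′ v ⊎ v ⊏′ u
  ⊏′-compare (old-old p)   (old-old q)   = old-compare p q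
  ⊏′-compare (old-copy p)  (old-copy q)  = old-compare p q
  ⊏′-compare (old-copy p)  (copy-copy _) = inj₁ (inj₂ (old-copy p))
  ⊏′-compare (old-top p)   (old-top q)   = old-compare p q
  ⊏′-compare (old-top p)   (copy-top _)  = inj₁ (inj₂ (old-copy p))
  ⊏′-compare (copy-copy _) (old-copy q)  = inj₂ (old-copy q)
  ⊏′-compare (copy-copy p) (copy-copy q) = copy-compare (inj₂ p) (inj₂ q)
  ⊏′-compare (copy-top _)  (old-top q)   = inj₂ (old-copy q)
  ⊏′-compare (copy-top p)  (copy-top q)  = copy-compare p q

  ⟶′⇒⊏′ : ∀ {u v} → u ⟶′ v → u ⊏′ v
  ⟶′⇒⊏′ (old-old e)   = old-old (⟶⇒⊏ e)
  ⟶′⇒⊏′ (old-top e)   = old-top (⟶⇒⊏ e)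
  ⟶′⇒⊏′ (copy-copy e) = copy-copy (⟶⇒⊏ e)
  ⟶′⇒⊏′ copy-top      = copy-top (inj₁ refl)

  ⇝′old : ∀ {x q} → x ⇝′ old q → ∃[ p ] (x ≡ old p × inj₁ p ⇝ inj₁ q)
  ⇝′old ε               = _ , refl , ε
  ⇝′old (old-old e ◅ r) with _ , eq , path ← ⇝′old r = _ , eq , e ◅ path

  -- No arc enters a copy from outside.
  ⇝′copy : ∀ {x τ z} → x ⇝′ copy τ z → ∃[ y ] (x ≡ copy τ y × y ⇝ z)
  ⇝′copy ε                 = _ , refl , ε
  ⇝′copy (copy-copy e ◅ r) with _ , eq , path ← ⇝′copy r = _ , eq , e ◅ path

  -- Everything above τ looks like τ itself to the vertices of P.
  collapse : V′ → V
  collapse (old p)    = inj₁ p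
  collapse (copy τ _) = inj₂ τ
  collapse (top τ _)  = inj₂ τ

  collapse-⊏ : ∀ {p v} → old p ⊏′ v → inj₁ p ⊏ collapse v
  collapse-⊏ (old-old p⊏q)  = p⊏q
  collapse-⊏ (old-copy p⊏τ) = p⊏τ
  collapse-⊏ (old-top p⊏τ)  = p⊏τ

  collapse-⟶ : ∀ {p v} → old p ⟶′ v → inj₁ p ⟶ collapse v
  collapse-⟶ (old-old e) = e
  collapse-⟶ (old-top e) = e

  collapse-⊑ : ∀ {u v} → u ⊑′ v → collapse u ⊑ collapse v
  collapse-⊑ (inj₁ refl)            = inj₁ refl
  collapse-⊑ (inj₂ (old-old p))     = inj₂ p
  collapse-⊑ (inj₂ (old-copy p))    = inj₂ p
  collapse-⊑ (inj₂ (old-top p))     = inj₂ p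
  collapse-⊑ (inj₂ (copy-copy _))   = inj₁ refl
  collapse-⊑ (inj₂ (copy-top _))    = inj₁ refl

  copy-⊑ : ∀ {τ y z} → copy τ y ⊑′ copy τ z → y ⊑ z
  copy-⊑ (inj₁ refl)            = inj₁ refl
  copy-⊑ (inj₂ (copy-copy y⊏z)) = inj₂ y⊏z

  -- For old tails, `collapse` reduces to the previous level. If only `v` is in a copy, then so is
  -- `x`, which cannot lie below an old `a`. Within a copy, an arc by `copy-top` leads from `y` to
  -- `top τ y` and jumps over no vertex; the remaining case is inherited from the copied level.
  noncrossing′ : ∀ {x a v m b w} → x ⊑′ a → x ⇝′ v → a ⊏′ v → v ⊏′ m →
                 m ⊑′ b → m ⊑′ w → a ⟶′ b → v ⟶′ w → ⊥
  noncrossing′ {a = old _} {v = old _} x⊑a x⇝v a⊏v v⊏m m⊑b m⊑w a⟶b v⟶w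
    with _ , refl , path ← ⇝′old x⇝v =
    noncrossing (collapse-⊑ x⊑a) path (collapse-⊏ a⊏v) (collapse-⊏ v⊏m)
                (collapse-⊑ m⊑b) (collapse-⊑ m⊑w) (collapse-⟶ a⟶b) (collapse-⟶ v⟶w)
  noncrossing′ {a = old _} {v = copy _ _} x⊑a x⇝v _ _ _ _ _ _ with _ , refl , _ ← ⇝′copy x⇝v
    with x⊑a
  ... | inj₁ ()
  ... | inj₂ ()
  noncrossing′ {a = copy _ _} _ _ (copy-copy a⊏v) v⊏m m⊑b _ copy-top _
    with copy-top v⊑a ← ⊏′-⊑′-trans v⊏m m⊑b = ⊏-irrefl (⊑-⊏-trans v⊑a a⊏v)
  noncrossing′ {a = copy _ _} x⊑a x⇝v (copy-copy a⊏v) (copy-copy v⊏m) m⊑b m⊑w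
               (copy-copy e) (copy-copy f)
    with _ , refl , path ← ⇝′copy x⇝v =
    noncrossing (copy-⊑ x⊑a) path a⊏v v⊏m (copy-⊑ m⊑b) (copy-⊑ m⊑w) e f
  noncrossing′ {a = copy _ _} _ _ (copy-copy _) (copy-copy v⊏m) _ (inj₂ (copy-top m⊑v))
               (copy-copy _) copy-top = ⊏-irrefl (⊑-⊏-trans m⊑v v⊏m)
  noncrossing′ {a = copy _ _} _ _ (copy-copy _) (copy-top _) (inj₁ ()) _ (copy-copy _) _
  noncrossing′ {a = copy _ _} _ _ (copy-copy _) (copy-top _) (inj₂ ()) _ (copy-copy _) _

  level : Level
  level = record
    { P = P′
    ; T = T′
    ; P-finite = ↔-trans (P-finite ⊎-↔ T′-finite) (↔-sym Fin.+↔⊎)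
    ; T-finite = T′-finite
    ; forest = record
      { _⊏_ = _⊏′_ ; _⟶_ = _⟶′_ ; _⊏?_ = _⊏′?_ ; _⟶?_ = _⟶′?_
      ; ⊏-irrefl = ⊏′-irrefl ; ⊏-trans = ⊏′-trans ; ⊏-compare = ⊏′-compare ; ⟶⇒⊏ = ⟶′⇒⊏′
      ; noncrossing = noncrossing′
      }
    }
    where
    T′-finite : Finite T′ _
    T′-finite = ↔-trans (T-finite ×-↔ finite) (↔-sym Fin.*↔×)

-- Tuples showing many colours in every proper colouring.

Rainbow : Level → ℕ → Set
Rainbow L k = ∀ {K} (f : P → Fin K) → (∀ {p q} → inj₁ p ⟶ inj₁ q → f p ≢ f q) →
    ∃[ τ ] Σ (Fin k → P) λ g → (∀ i → inj₁ (g i) ⟶ inj₂ τ) × Injective _≡_ _≡_ (f ∘ g)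
  where open Level L

-- Pigeonhole: otherwise `suc k` distinct values would all be among the `k` values of `g`.
new-value : ∀ {k K} (g : Fin k → Fin K) (h : Fin (suc k) → Fin K) → Injective _≡_ _≡_ h →
            ∃[ i ] (∀ j → h i ≢ g j)
new-value {k} g h h-injective with Fin.any? (λ i → Fin.all? λ j → ¬? (h i Fin.≟ g j))
... | yes found = found
... | no ¬found = ⊥-elim (<-irrefl refl (Fin.injective⇒≤ {f = λ i → proj₁ (hit i)} hit-injective))
  where
  hit : ∀ i → ∃[ j ] h i ≡ g j
  hit i = decidable-stable (Fin.any? λ j → h i Fin.≟ g j)
    λ ¬hit → ¬found (i , λ j eq → ¬hit (j , eq))
  hit-injective : Injective _≡_ _≡_ (λ i → proj₁ (hit i))
  hit-injective {i} {j} eq =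
    h-injective (trans (proj₂ (hit i)) (trans (cong g eq) (sym (proj₂ (hit j)))))

prepend-injective : ∀ {k} {A B : Set} (f : A → B) (a : A) (g : Fin k → A) →
  Injective _≡_ _≡_ (f ∘ g) → (∀ i → f a ≢ f (g i)) →
  Σ (Fin (suc k) → A) λ h → Injective _≡_ _≡_ (f ∘ h) ×
    (∀ (Q : A → Set) → Q a → (∀ i → Q (g i)) → ∀ i → Q (h i))
prepend-injective {k} {A} f a g g-inj fresh =
    h , h-inj , λ { _ q qs Fin.zero → q ; _ q qs (Fin.suc i) → qs i }
  where
  h : Fin (suc k) → A
  h Fin.zero    = a
  h (Fin.suc i) = g i
  h-inj : Injective _≡_ _≡_ (f ∘ h)
  h-inj {Fin.zero}  {Fin.zero}  _  = refl
  h-inj {Fin.zero}  {Fin.suc j} eq = ⊥-elim (fresh j eq)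
  h-inj {Fin.suc i} {Fin.zero}  eq = ⊥-elim (fresh i (sym eq))
  h-inj {Fin.suc i} {Fin.suc j} eq = cong Fin.suc (g-inj eq)

rainbow-base : Rainbow base 0
rainbow-base f proper = _ , (λ ()) , (λ ()) , λ { {()} }

rainbow-next : ∀ L {k} → Rainbow L k → Rainbow (Next.level L) (suc k)
rainbow-next L rainbow f proper =
  let τ , g , g⟶τ , g-inj = rainbow (f ∘ inj₁) (proper ∘ old-old)
      σ , h , h⟶σ , h-inj = rainbow (λ p → f (inj₂ (τ , inj₁ p))) (proper ∘ copy-copy)
      -- In the copy, `σ` is an ordinary coloured vertex joined from its whole tuple, so together
      -- they show `suc k` colours.
      y , y-inj , _       = prepend-injective (λ y → f (inj₂ (τ , y))) (inj₂ σ) (inj₁ ∘ h) h-inj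
                              (λ i eq → proper (copy-copy (h⟶σ i)) (sym eq))
      i , new             = new-value (f ∘ inj₁ ∘ g) (λ i → f (inj₂ (τ , y i))) y-inj
      τ′                  = τ , y i
      g′ , g′-inj , all   = prepend-injective f (inj₂ τ′) (inj₁ ∘ g) g-inj new
  in τ′ , g′ , all (λ p → inj₁ p ⟶′ inj₂ τ′) copy-top (λ j → old-top (g⟶τ j)) , g′-inj
  where
  open Next L

rainbow-level : ∀ k → Σ Level λ L → Rainbow L k
rainbow-level zero    = base , rainbow-base
rainbow-level (suc k) = let L , rainbow = rainbow-level k in Next.level L , rainbow-next L rainbow

theorem1p1 : (t : ℕ) → 3 ≤ t →
    ((N : ℕ) → Σ Digraph (λ D → IsChordal t D × CliqueNumber≤ D 3 × Dichromatic≥ D N))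
    × (3 < t → (N : ℕ) → Σ Digraph (λ D → IsChordal t D × CliqueNumber≤ D 2 × Dichromatic≥ D N))
theorem1p1 (suc (suc (suc r))) (s≤s (s≤s (s≤s _))) =
  (λ N → digraph N , chordal N , clique-number≤3 N , dichromatic N) ,
  (λ 3<t N → digraph N , chordal N ,
     clique-number≤2 N (λ { refl → <-irrefl refl 3<t }) , dichromatic N)
  where
  -- Each of `N` colours refines into `t = 3 + r` pairs with a rank, so `N * t` colours have to be
  -- forced.
  stage : ∀ N → Σ Level λ L → Rainbow L (N * (3 + r))
  stage N = rainbow-level (N * (3 + r))
  module R (N : ℕ) where
    open Level (proj₁ (stage N)) using (forest; finite)
    open Closure forest r public
    open Realisation finite public
  open R
  dichromatic : ∀ N → Dichromatic≥ (digraph N) N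
  dichromatic N = dichromatic≥ N λ g proper →
    let _ , _ , _ , inj = proj₂ (stage N) (g ∘ inj₁) proper in Fin.injective⇒≤ inj
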